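{- For every message $M$ and formulas $\phi,\psi$: $\vdash(\langle M\rangle\phi\to[M]\psi)\to[M](\phi\to\psi)$.
   Context: Fix a finite set $\mathcal{A}$ of agent names containing a distinguished name $\mathsf{CM}$. Messages: $M ::= a \mid B \mid (M,M)$ ($a\in\mathcal{A}$, $B$ optional data constants, pairs). $\mathcal{P}$ is a denumerable set of propositional variables containing atoms $\mathsf{k}_a(M)$ ("$a$ knows $M$"). Formulas: $\phi ::= P \mid \phi\wedge\phi \mid \phi\vee\phi \mid \neg\phi \mid \phi\to\phi \mid [M]\phi$. Abbreviations: $\mathrm{true}:=\mathsf{k}_{\mathsf{CM}}(\mathsf{CM})$, $\mathrm{false}:=\neg\mathrm{true}$, $\phi\leftrightarrow\psi:=(\phi\to\psi)\wedge(\psi\to\phi)$, $\langle M\rangle\phi:=\neg\neg(\mathsf{k}_{\mathsf{CM}}(M)\wedge\phi)$. LIiP is the smallest set of formulas containing all instances of: the axioms of an adequate Hilbert axiomatization of intuitionistic propositional logic; $\mathsf{k}_a(a)$; $(\mathsf{k}_a(M)\wedge\mathsf{k}_a(M'))\leftrightarrow\mathsf{k}_a((M,M'))$; $[M]\mathsf{k}_{\mathsf{CM}}(M)$; $[M](\phi\to\psi)\to([M]\phi\to[M]\psi)$; $[M]\phi\to(\mathsf{k}_{\mathsf{CM}}(M)\to\phi)$; $[M]\phi\to\langle M\rangle\phi$; $\phi\to[M]\phi$; and closed under modus ponens and the rule: if $\mathsf{k}_{\mathsf{CM}}(M)\to\mathsf{k}_{\mathsf{CM}}(M')$ is in the set then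 so is $[M']\phi\to[M]\phi$ for every $\phi$. Write $\vdash\phi$ for $\phi\in\mathrm{LIiP}$. -}

module Defs where

open import Data.Fin.Base using (Fin)
open import Data.Nat.Base using (ℕ)
open import Data.Product.Base using (∃; _×_; _,_)
open import Function.Bundles using (_↔_; _↣_; Injection)

data Message (Agent Data : Set) : Set where
  agent : Agent → Message Agent Data
  datum : Data → Message Agent Data
  pair  : Message Agent Data → Message Agent Data → Message Agent Data

-- The parameters of the logic.  `Data` may be empty, since data constants are
-- optional.  The atoms "a knows M" are pairwise distinct propositional
-- variables; there may or may not be others.
record Signature : Set₁ where
  field
    Agent       : Set
    finite      : ∃ λ n → Agent ↔ Fin n
    CM          : Agent
    Data        : Set
    PropVar     : Set
    denumerable : PropVar ↔ ℕ
    knowledge   : (Agent × Message Agent Data) ↣ PropVar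

module LIiP (𝒮 : Signature) where
  open Signature 𝒮

  Msg : Set
  Msg = Message Agent Data

  infix  9 ¬_ [_]_ ⟨_⟩_
  infixr 8 _∧_
  infixr 7 _∨_
  infixr 6 _⇒_
  infix  5 _⇔_
  infix  3 ⊢_

  data Formula : Set where
    var  : PropVar → Formula
    _∧_  : Formula → Formula → Formula
    _∨_  : Formula → Formula → Formula
    ¬_   : Formula → Formula
    _⇒_  : Formula → Formula → Formula
    [_]_ : Msg → Formula → Formula

  k : Agent → Msg → Formula
  k a M = var (Injection.to knowledge (a , M))

  true : Formula
  true = k CM (agent CM)

  false : Formula
  false = ¬ true

  _⇔_ : Formula → Formula → Formula
  φ ⇔ ψ = (φ ⇒ ψ) ∧ (ψ ⇒ φ)

  ⟨_⟩_ : Msg → Formula → Formula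
  ⟨ M ⟩ φ = ¬ (¬ (k CM M ∧ φ))

  -- Negation is primitive and `false` is itself a negation, so the
  -- propositional axioms are those of Kleene's Hilbert system for
  -- intuitionistic logic: →-K to ∨-elim give its positive fragment, and
  -- ¬-intro (reductio) and ¬-elim (ex falso) govern negation.
  data ⊢_ : Formula → Set where
    →-K     : ∀ φ ψ → ⊢ φ ⇒ (ψ ⇒ φ)
    →-S     : ∀ φ ψ χ → ⊢ (φ ⇒ (ψ ⇒ χ)) ⇒ ((φ ⇒ ψ) ⇒ (φ ⇒ χ))
    ∧-elim₁ : ∀ φ ψ → ⊢ (φ ∧ ψ) ⇒ φ
    ∧-elim₂ : ∀ φ ψ → ⊢ (φ ∧ ψ) ⇒ ψ
    ∧-intro : ∀ φ ψ → ⊢ φ ⇒ (ψ ⇒ (φ ∧ ψ))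
    ∨-intro₁ : ∀ φ ψ → ⊢ φ ⇒ (φ ∨ ψ)
    ∨-intro₂ : ∀ φ ψ → ⊢ ψ ⇒ (φ ∨ ψ)
    ∨-elim  : ∀ φ ψ χ → ⊢ (φ ⇒ χ) ⇒ ((ψ ⇒ χ) ⇒ ((φ ∨ ψ) ⇒ χ))
    ¬-intro : ∀ φ ψ → ⊢ (φ ⇒ ψ) ⇒ ((φ ⇒ ¬ ψ) ⇒ ¬ φ)
    ¬-elim  : ∀ φ ψ → ⊢ ¬ φ ⇒ (φ ⇒ ψ)

    k-self  : ∀ a → ⊢ k a (agent a)
    k-pair  : ∀ a M M′ → ⊢ (k a M ∧ k a M′) ⇔ k a (pair M M′)
    []-k    : ∀ M → ⊢ [ M ] k CM M
    []-K    : ∀ M φ ψ → ⊢ ([ M ] (φ ⇒ ψ)) ⇒ (([ M ] φ) ⇒ ([ M ] ψ))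
    []-T    : ∀ M φ → ⊢ ([ M ] φ) ⇒ (k CM M ⇒ φ)
    []-D    : ∀ M φ → ⊢ ([ M ] φ) ⇒ (⟨ M ⟩ φ)
    []-intro : ∀ M φ → ⊢ φ ⇒ ([ M ] φ)

    mp      : ∀ {φ ψ} → ⊢ φ ⇒ ψ → ⊢ φ → ⊢ ψ
    []-anti : ∀ {M M′} → ⊢ k CM M ⇒ k CM M′ →
              ∀ φ → ⊢ ([ M′ ] φ) ⇒ ([ M ] φ)

{-# OPTIONS --safe #-}
-- Since χ → [M]χ is an axiom and [M] k_CM(M) holds, anything that χ and
-- k_CM(M) imply together holds under [M] once χ does.  Take χ to be
-- ⟨M⟩φ → [M]ψ: from k_CM(M) and φ we get ⟨M⟩φ by double-negation
-- introduction, hence [M]ψ, and then ψ since k_CM(M) makes [M] factive.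
module Submission where

open import Defs

module Derivations (𝒮 : Signature) where
  open Signature 𝒮 using (CM)
  open LIiP 𝒮

  ⇒-refl : ∀ {φ} → ⊢ φ ⇒ φ
  ⇒-refl {φ} = mp (mp (→-S φ (φ ⇒ φ) φ) (→-K φ (φ ⇒ φ))) (→-K φ φ)

  ⇒-const : ∀ {χ φ} → ⊢ φ → ⊢ χ ⇒ φ
  ⇒-const = mp (→-K _ _)

  -- Together with `⇒-const`, this replaces a deduction theorem: `χ` acts as the context.
  ⇒-ap : ∀ {χ φ ψ} → ⊢ χ ⇒ (φ ⇒ ψ) → ⊢ χ ⇒ φ → ⊢ χ ⇒ ψ
  ⇒-ap f x = mp (mp (→-S _ _ _) f) x

  ⇒-trans : ∀ {φ ψ χ} → ⊢ φ ⇒ ψ → ⊢ ψ ⇒ χ → ⊢ φ ⇒ χ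
  ⇒-trans f g = ⇒-ap (⇒-const g) f

  ⇒-pair : ∀ {χ φ ψ} → ⊢ χ ⇒ φ → ⊢ χ ⇒ ψ → ⊢ χ ⇒ (φ ∧ ψ)
  ⇒-pair f g = ⇒-ap (⇒-trans f (∧-intro _ _)) g

  ⇒-curry : ∀ {φ ψ χ} → ⊢ (φ ∧ ψ) ⇒ χ → ⊢ φ ⇒ (ψ ⇒ χ)
  ⇒-curry f = ⇒-trans (∧-intro _ _) (mp (→-S _ _ _) (⇒-const f))

  ¬¬-intro : ∀ {φ} → ⊢ φ ⇒ ¬ (¬ φ)
  -- Reductio on `¬ φ`: it implies `φ` by `→-K` and `¬ φ` by reflexivity.
  ¬¬-intro = ⇒-ap (⇒-trans (→-K _ _) (¬-intro _ _)) (⇒-const ⇒-refl)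

  []-relativize : ∀ {M χ φ} → ⊢ χ ⇒ (k CM M ⇒ φ) → ⊢ χ ⇒ ([ M ] φ)
  []-relativize {M} f =
    -- Box the implication `k CM M ⇒ φ`, distribute by `[]-K`, and discharge the boxed antecedent.
    ⇒-ap (⇒-trans (⇒-trans f ([]-intro M _)) ([]-K M _ _)) (⇒-const ([]-k M))

  ⟨⟩⇒[]-factive : ∀ M φ ψ →
    ⊢ ((⟨ M ⟩ φ) ⇒ ([ M ] ψ)) ⇒ (k CM M ⇒ (φ ⇒ ψ))
  ⟨⟩⇒[]-factive M φ ψ = ⇒-curry (⇒-curry (⇒-ap (⇒-trans boxed ([]-T M ψ)) known))
    where
    -- The three hypotheses as one context, nested to the left so that two uses of `⇒-curry` release
    -- them in order.
    Γ : Formula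
    Γ = (((⟨ M ⟩ φ) ⇒ ([ M ] ψ)) ∧ k CM M) ∧ φ

    known : ⊢ Γ ⇒ k CM M
    known = ⇒-trans (∧-elim₁ _ _) (∧-elim₂ _ _)

    boxed : ⊢ Γ ⇒ ([ M ] ψ)
    boxed = ⇒-ap (⇒-trans (∧-elim₁ _ _) (∧-elim₁ _ _))
                 (⇒-trans (⇒-pair known (∧-elim₂ _ _)) ¬¬-intro)

theorem2p46 : (𝒮 : Signature) → let open LIiP 𝒮 in
    (M : Msg) (φ ψ : Formula) →
    ⊢ ((⟨ M ⟩ φ) ⇒ ([ M ] ψ)) ⇒ ([ M ] (φ ⇒ ψ))
theorem2p46 𝒮 M φ ψ = []-relativize (⟨⟩⇒[]-factive M φ ψ)
  where open Derivations 𝒮
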